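{- Let $n\ge 4$ be an integer. The hypergraph $\mathcal{H}(n,4,2|\sigma)$ with $\sigma=(2,2)$ has a gap in its $(2,2)$-spectrum.
   Context: The hypergraph $\mathcal{H}(n,4,2|\sigma)$ with $\sigma=(2,2)$ has $2n$ vertices, partitioned into $n$ classes of size $2$; its edges are the $4$-subsets of vertices whose non-zero intersection sizes with the classes form the partition $(2,2)$ of $4$, i.e. the unions of two distinct classes. For integers $2\le\alpha\le\beta\le r$, an $(\alpha,\beta)$-colouring of an $r$-uniform hypergraph is a colouring of its vertices such that the number of distinct colours appearing on every edge is at least $\alpha$ and at most $\beta$. A $k$-$(\alpha,\beta)$-colouring is an $(\alpha,\beta)$-colouring using exactly $k$ distinct colours (all $k$ are used). The $(\alpha,\beta)$-spectrum of a hypergraph is the set of all positive integers $k$ for which it has a $k$-$(\alpha,\beta)$-colouring; it has a gap if there are $k_1<k_2<k_3$ with $k_1,k_3$ in the spectrum and $k_2$ not in the spectrum. -}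

module Defs where

open import Data.Fin.Base using (Fin; quotient)
open import Data.Fin.Properties using () renaming (_≟_ to _≟ᶠ_)
open import Data.Fin.Subset using (Subset; ⊤; _∩_; ∣_∣)
open import Data.Fin.Subset.Properties using (_∈?_)
open import Data.List.Base using (List; length; map; filter; allFin; deduplicate)
open import Data.List.Relation.Binary.Permutation.Propositional using (_↭_)
open import Data.Nat.Base using (ℕ; _*_; _≤_; _<_)
open import Data.Nat.Properties using (_≟_; _>?_)
open import Data.Product.Base using (_×_; proj₁; ∃-syntax)
open import Data.Vec.Base using (tabulate)
open import Level using (0ℓ)
open import Relation.Binary.PropositionalEquality using (_≡_)
open import Relation.Nullary.Decidable using (⌊_⌋)
open import Relation.Nullary.Negation using (¬_)
open import Relation.Unary using (Pred)

record UniformHypergraph (r : ℕ) : Set₁ where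
  field
    order   : ℕ
    IsEdge  : Subset order → Set
    uniform : ∀ e → IsEdge e → ∣ e ∣ ≡ r

open UniformHypergraph public

-- The n * q vertices are split into n consecutive blocks of q vertices.
class : ∀ {n} q → Fin n → Subset (n * q)
class q i = tabulate (λ v → ⌊ quotient q v ≟ᶠ i ⌋)

-- The multiset of non-zero sizes of the intersections of e with the classes,
-- listed in the order of the classes; it is to be compared up to permutation.
intersectionSizes : ∀ n q → Subset (n * q) → List ℕ
intersectionSizes n q e = filter (_>? 0) (map (λ i → ∣ e ∩ class q i ∣) (allFin n))

-- 𝓗 n r q σ is the hypergraph H(n,r,q|σ); σ is a partition of r, written as
-- the list of its parts.
𝓗 : (n r q : ℕ) (σ : List ℕ) → UniformHypergraph r
𝓗 n r q σ = record
  { order   = n * q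
  ; IsEdge  = λ e → ∣ e ∣ ≡ r × intersectionSizes n q e ↭ σ
  ; uniform = λ _ → proj₁
  }

-- Colours are named by natural numbers; a colouring of a finite vertex set
-- uses only finitely many of them, and which ones is immaterial.
Colouring : ∀ {r} → UniformHypergraph r → Set
Colouring H = Fin (order H) → ℕ

numColours : ∀ {m} → (Fin m → ℕ) → Subset m → ℕ
numColours {m} c s = length (deduplicate _≟_ (map c (filter (_∈? s) (allFin m))))

-- Meant for 2 ≤ α ≤ β ≤ r.
IsColouring : ∀ {r} (α β : ℕ) (H : UniformHypergraph r) → Colouring H → Set
IsColouring α β H c =
  ∀ e → IsEdge H e → α ≤ numColours c e × numColours c e ≤ β

IsKColouring : ∀ {r} (k α β : ℕ) (H : UniformHypergraph r) → Colouring H → Set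
IsKColouring k α β H c = IsColouring α β H c × numColours c ⊤ ≡ k

Spectrum : ∀ {r} (α β : ℕ) → UniformHypergraph r → Pred ℕ 0ℓ
Spectrum α β H k = 0 < k × ∃[ c ] IsKColouring k α β H c

HasGap : Pred ℕ 0ℓ → Set
HasGap S =
  ∃[ k₁ ] ∃[ k₂ ] ∃[ k₃ ] (k₁ < k₂ × k₂ < k₃ × S k₁ × S k₃ × ¬ S k₂)

{-# OPTIONS --safe #-}
module Submission where

-- The (2,2)-spectrum is {2, n}. If some class has two colours, then every other class uses only
-- these, as the union of the two classes has exactly two colours. If every class is monochromatic,
-- then distinct classes have distinct colours. Both cases occur, and 2 < 3 < n.

open import Defs
open import Data.Bool.Base using (true; false)
open import Data.Fin.Base using (Fin; zero; suc; toℕ; combine; quotient; remainder)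
open import Data.Fin.Properties
  using (any?; combine-injective; combine-remQuot; remQuot-combine; toℕ-injective)
  renaming (_≟_ to _≟ᶠ_)
open import Data.Fin.Subset using (Subset; inside; outside; ⊤; _∩_; _∪_; ∣_∣; _⊆_)
  renaming (_∈_ to _∈ₛ_)
open import Data.Fin.Subset.Properties
  using ( _∈?_; ∈⊤; x∈p∩q⁺; x∈p∩q⁻; x∈p∪q⁺; x∈p∪q⁻; p∩q⊆q; ⊆-antisym
        ; p⊂q⇒∣p∣<∣q∣; x∈p⇒∣p-x∣<∣p∣; drop-there)
open import Data.List.Base
  using (List; []; _∷_; length; map; filter; allFin; tabulate; cartesianProductWith; _++_)
open import Data.List.Membership.DecPropositional using () renaming (_∈?_ to member?)
open import Data.List.Membership.Propositional using (_∈_)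
open import Data.List.Membership.Propositional.Properties
  using ( ∈-∃++; ∈-++⁺ˡ; ∈-++⁺ʳ; ∈-++⁻; ∈-map⁺; ∈-map⁻; ∈-filter⁺; ∈-filter⁻; ∈-allFin
        ; ∈-deduplicate⁺; ∈-deduplicate⁻; ∈-cartesianProductWith⁺; ∈-cartesianProductWith⁻)
open import Data.List.Membership.Propositional.Properties.WithK using (unique∧set⇒bag)
open import Data.List.Properties
  using (length-++; length-map; map-∘; length-tabulate; filter-accept; filter-reject)
open import Data.List.Relation.Binary.BagAndSetEquality using (∼bag⇒↭)
open import Data.List.Relation.Binary.Permutation.Propositional using (_↭_)
open import Data.List.Relation.Binary.Permutation.Propositional.Properties
  using (map⁺; ↭-length; ∈-resp-↭)
open import Data.List.Relation.Binary.Subset.Propositional using () renaming (_⊆_ to _⊆ₗ_)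
open import Data.List.Relation.Unary.All using ([]; _∷_)
open import Data.List.Relation.Unary.AllPairs using ([]; _∷_)
open import Data.List.Relation.Unary.Any using (here; there)
open import Data.List.Relation.Unary.Unique.DecPropositional.Properties using (deduplicate-!)
open import Data.List.Relation.Unary.Unique.Propositional using (Unique)
open import Data.List.Relation.Unary.Unique.Propositional.Properties
  using (Unique[x∷xs]⇒x∉xs; allFin⁺; filter⁺; cartesianProductWith⁺)
  renaming (map⁺ to unique-map⁺)
open import Data.Nat.Base using (ℕ; suc; _+_; _*_; _≤_; _<_; _≥_; z≤n; s≤s; z<s)
open import Data.Nat.Properties
  using (_≟_; _>?_; ≤-antisym; ≤-refl; ≤-trans; <⇒≢; <⇒≱; +-suc; module ≤-Reasoning)
open import Data.Product.Base using (_×_; _,_; proj₁; proj₂; ∃₂)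
open import Data.Sum.Base using (_⊎_; inj₁; inj₂)
open import Data.Vec.Base using ([]; _∷_; here; there)
open import Data.Vec.Properties using (lookup∘tabulate; lookup⇒[]=; []=⇒lookup)
open import Function.Base using (_∘_; id; case_of_)
open import Function.Bundles using (_⇔_; mk⇔)
open Function.Bundles.Equivalence using (to; from)
open import Relation.Binary.PropositionalEquality
  using (_≡_; _≢_; refl; sym; trans; cong; cong₂; subst; subst₂)
open import Relation.Nullary using (¬_; yes; no; does; contradiction)
open import Relation.Nullary.Decidable using (¬?; decidable-stable; isYes≗does; dec-true)
open import Relation.Unary using (Pred; Decidable)

-- Duplicate-free lists and the cardinality of subsets.

module _ {a} {A : Set a} where

  -- Pigeonhole by induction on `xs`: once one occurrence of `x` is cut out of `ys`, the tail of
  -- `xs` still lies in what remains, because it avoids `x`.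
  unique∧⊆⇒length≤ : ∀ {xs ys : List A} → Unique xs → xs ⊆ₗ ys → length xs ≤ length ys
  unique∧⊆⇒length≤ {xs = []}     _              _     = z≤n
  unique∧⊆⇒length≤ {xs = x ∷ xs} u@(_ ∷ xs!) xs⊆ys with ∈-∃++ (xs⊆ys (here refl))
  ... | ls , rs , refl = begin
    suc (length xs)             ≤⟨ s≤s (unique∧⊆⇒length≤ xs! xs⊆ls++rs) ⟩
    suc (length (ls ++ rs))     ≡⟨ cong suc (length-++ ls) ⟩
    suc (length ls + length rs) ≡⟨ +-suc (length ls) (length rs) ⟨
    length ls + length (x ∷ rs) ≡⟨ length-++ ls ⟨
    length (ls ++ x ∷ rs)       ∎
    where
    open ≤-Reasoning
    xs⊆ls++rs : xs ⊆ₗ ls ++ rs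
    xs⊆ls++rs y∈xs with ∈-++⁻ ls (xs⊆ys (there y∈xs))
    ... | inj₁ y∈ls         = ∈-++⁺ˡ y∈ls
    ... | inj₂ (here refl)  = contradiction y∈xs (Unique[x∷xs]⇒x∉xs u)
    ... | inj₂ (there y∈rs) = ∈-++⁺ʳ ls y∈rs

  -- Without repetitions every multiplicity is 0 or 1, so membership alone determines the multiset.
  unique∧set⇒↭ : ∀ {xs ys : List A} → Unique xs → Unique ys → (∀ {x} → x ∈ xs ⇔ x ∈ ys) → xs ↭ ys
  unique∧set⇒↭ xs! ys! eq = ∼bag⇒↭ (unique∧set⇒bag xs! ys! eq)

  unique-pair : ∀ {x y : A} → x ≢ y → Unique (x ∷ y ∷ [])
  unique-pair x≢y = (x≢y ∷ []) ∷ [] ∷ []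

  -- Serves to pass from the list of non-zero intersection sizes to the list of the classes that
  -- have them.
  filter-map : ∀ {b p} {B : Set b} {P : Pred B p} (P? : Decidable P) (f : A → B) (xs : List A) →
               filter P? (map f xs) ≡ map f (filter (P? ∘ f) xs)
  filter-map P? f []       = refl
  filter-map P? f (x ∷ xs) with does (P? (f x))
  ... | true  = cong (f x ∷_) (filter-map P? f xs)
  ... | false = filter-map P? f xs

  -- The case of interest is `allFin`, which is `tabulate id`; a general `f` lets the induction on
  -- `s` move on to `f ∘ suc`.
  length-filter-tabulate : ∀ {n p} {P : Pred A p} (P? : Decidable P) (f : Fin n → A) (s : Subset n) →
                           (∀ i → P (f i) ⇔ i ∈ₛ s) → length (filter P? (tabulate f)) ≡ ∣ s ∣
  length-filter-tabulate P? f []            P⇔s = refl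
  length-filter-tabulate P? f (inside ∷ s)  P⇔s = trans
    (cong length (filter-accept P? (from (P⇔s zero) here)))
    (cong suc (length-filter-tabulate P? (f ∘ suc) s
      λ i → mk⇔ (drop-there ∘ to (P⇔s (suc i))) (from (P⇔s (suc i)) ∘ there)))
  length-filter-tabulate P? f (outside ∷ s) P⇔s = trans
    (cong length (filter-reject P? λ p → contradiction (to (P⇔s zero) p) λ ()))
    (length-filter-tabulate P? (f ∘ suc) s
      λ i → mk⇔ (drop-there ∘ to (P⇔s (suc i))) (from (P⇔s (suc i)) ∘ there))

∣s∣≡length : ∀ {m} {s : Subset m} {xs} → Unique xs → (∀ {v} → v ∈ xs ⇔ v ∈ₛ s) → ∣ s ∣ ≡ length xs
∣s∣≡length {m} {s} xs! xs⇔s = trans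
  (sym (length-filter-tabulate (_∈? s) id s λ _ → mk⇔ id id))
  (↭-length (unique∧set⇒↭ (filter⁺ (_∈? s) (allFin⁺ m)) xs!
    (mk⇔ (λ v∈ → from xs⇔s (proj₂ (∈-filter⁻ (_∈? s) {xs = allFin m} v∈)))
         (λ v∈ → ∈-filter⁺ (_∈? s) (∈-allFin _) (to xs⇔s v∈)))))

-- Bounds on the number of colours.

module _ {m} (c : Fin m → ℕ) (s : Subset m) where

  numColours≤length : ∀ ks → (∀ {v} → v ∈ₛ s → c v ∈ ks) → numColours c s ≤ length ks
  numColours≤length ks cs⊆ks = unique∧⊆⇒length≤ (deduplicate-! _≟_ colours) λ k∈ →
    let v , v∈ , k≡cv = ∈-map⁻ c (∈-deduplicate⁻ _≟_ colours k∈)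
    in subst (_∈ ks) (sym k≡cv) (cs⊆ks (proj₂ (∈-filter⁻ (_∈? s) {xs = allFin m} v∈)))
    where colours = map c (filter (_∈? s) (allFin m))

  -- Lower bounds come from exhibiting vertices of `s` with pairwise different colours.
  length≤numColours : ∀ {vs} → Unique (map c vs) → (∀ {v} → v ∈ vs → v ∈ₛ s) → length vs ≤ numColours c s
  length≤numColours {vs} cvs! vs⊆s = subst (_≤ numColours c s) (length-map c vs)
    (unique∧⊆⇒length≤ cvs! λ k∈ →
      let v , v∈ , k≡cv = ∈-map⁻ c k∈
      in subst (_∈ _) (sym k≡cv)
           (∈-deduplicate⁺ _≟_ (∈-map⁺ c (∈-filter⁺ (_∈? s) (∈-allFin v) (vs⊆s v∈)))))

-- Classes and their unions.

module _ {n : ℕ} (q : ℕ) where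

  quotient-combine : ∀ (i : Fin n) (j : Fin q) → quotient {n} q (combine i j) ≡ i
  quotient-combine i j = cong proj₁ (remQuot-combine i j)

  remainder-combine : ∀ (i : Fin n) (j : Fin q) → remainder {n} q (combine i j) ≡ j
  remainder-combine i j = cong proj₂ (remQuot-combine {n} i j)

  ∈-class⁺ : ∀ {i : Fin n} {v} → quotient q v ≡ i → v ∈ₛ class q i
  ∈-class⁺ {i} {v} eq = lookup⇒[]= v (class q i)
    (trans (lookup∘tabulate _ v)
      (trans (isYes≗does (quotient q v ≟ᶠ i)) (dec-true (quotient q v ≟ᶠ i) eq)))

  ∈-class⁻ : ∀ {i : Fin n} {v} → v ∈ₛ class q i → quotient q v ≡ i
  ∈-class⁻ {i} {v} v∈ with quotient q v ≟ᶠ i | trans (sym (lookup∘tabulate _ v)) ([]=⇒lookup v∈)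
  ... | yes eq | _  = eq
  ... | no  _  | ()

  combine∈class : ∀ (i : Fin n) j → combine i j ∈ₛ class q i
  combine∈class i j = ∈-class⁺ (quotient-combine i j)

  -- A vertex is determined by its class and its position there, so `combine` lists the union
  -- without repetition. The lemma is applied to no class, to one class and to two classes.
  ∣unionOfClasses∣ : ∀ {s : Subset (n * q)} {is} → Unique is → (∀ {v} → v ∈ₛ s ⇔ quotient q v ∈ is) →
                     ∣ s ∣ ≡ length (cartesianProductWith combine is (allFin q))
  ∣unionOfClasses∣ {s} {is} is! s⇔is = ∣s∣≡length
    (cartesianProductWith⁺ combine (combine-injective _ _ _ _) is! (allFin⁺ q))
    (mk⇔ to′ from′)
    where
    to′ : ∀ {v} → v ∈ cartesianProductWith combine is (allFin q) → v ∈ₛ s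
    to′ v∈ with i , j , i∈ , _ , refl ← ∈-cartesianProductWith⁻ combine is (allFin q) v∈ =
      from s⇔is (subst (_∈ is) (sym (quotient-combine i j)) i∈)
    from′ : ∀ {v} → v ∈ₛ s → v ∈ cartesianProductWith combine is (allFin q)
    from′ {v} v∈ = subst (_∈ _) (combine-remQuot {n} q v)
      (∈-cartesianProductWith⁺ combine (to s⇔is v∈) (∈-allFin (remainder {n} q v)))

-- Edges are the unions of two distinct classes.

Edge : (n : ℕ) → Subset (n * 2) → Set
Edge n = IsEdge (𝓗 n 4 2 (2 ∷ 2 ∷ []))

∣class∣ : ∀ {n} (i : Fin n) → ∣ class 2 i ∣ ≡ 2
∣class∣ i = ∣unionOfClasses∣ 2 {is = i ∷ []} ([] ∷ [])
  (mk⇔ (here ∘ ∈-class⁻ 2) λ { (here eq) → ∈-class⁺ 2 eq })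

-- The sizes attained on the classes meeting `e` are a permutation of 2, 2; hence just two classes
-- meet `e`, and each of them, having two vertices, lies inside `e`.
edge⇒classes : ∀ {n} (e : Subset (n * 2)) → Edge n e →
  ∃₂ λ (i j : Fin n) → i ≢ j × class 2 i ⊆ e × class 2 j ⊆ e × (∀ {v} → v ∈ₛ e → quotient {n} 2 v ∈ i ∷ j ∷ [])
edge⇒classes {n} e (_ , sizes) = split met (filter⁺ _ (allFin⁺ n))
  (subst (_↭ 2 ∷ 2 ∷ []) (filter-map (_>? 0) size (allFin n)) sizes) quotient∈met
  where
  size : Fin n → ℕ
  size i = ∣ e ∩ class 2 i ∣

  met : List (Fin n)
  met = filter (λ i → size i >? 0) (allFin n)

  quotient∈met : ∀ {v} → v ∈ₛ e → quotient 2 v ∈ met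
  quotient∈met v∈e = ∈-filter⁺ (λ i → size i >? 0) (∈-allFin _)
    (nonempty⇒∣p∣>0 (x∈p∩q⁺ (v∈e , ∈-class⁺ 2 refl)))
    where
    nonempty⇒∣p∣>0 : ∀ {m} {p : Subset m} {x} → x ∈ₛ p → 0 < ∣ p ∣
    nonempty⇒∣p∣>0 x∈p = ≤-trans (s≤s z≤n) (x∈p⇒∣p-x∣<∣p∣ x∈p)

  full : ∀ {i} → size i ∈ 2 ∷ 2 ∷ [] → class 2 i ⊆ e
  full {i} size∈ {v} v∈ with v ∈? e
  ... | yes v∈e = v∈e
  -- A vertex of the class missing from `e` would make the intersection a proper subset of the
  -- class, of size below 2.
  ... | no  v∉e = contradiction (trans (size≡2 size∈) (sym (∣class∣ i)))
    (<⇒≢ (p⊂q⇒∣p∣<∣q∣ (p∩q⊆q e _ , v , v∈ , v∉e ∘ proj₁ ∘ x∈p∩q⁻ e _)))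
    where
    size≡2 : ∀ {k} → k ∈ 2 ∷ 2 ∷ [] → k ≡ 2
    size≡2 (here eq)         = eq
    size≡2 (there (here eq)) = eq

  -- Stated for a variable list in place of `met`, so that its length can be found by pattern
  -- matching.
  split : ∀ is → Unique is → map size is ↭ 2 ∷ 2 ∷ [] → (∀ {v} → v ∈ₛ e → quotient {n} 2 v ∈ is) →
    ∃₂ λ (i j : Fin n) → i ≢ j × class 2 i ⊆ e × class 2 j ⊆ e × (∀ {v} → v ∈ₛ e → quotient {n} 2 v ∈ i ∷ j ∷ [])
  split []              _                   eq _  = contradiction (↭-length eq) λ ()
  split (_ ∷ [])        _                   eq _  = contradiction (↭-length eq) λ ()
  split (i ∷ j ∷ [])    ((i≢j ∷ _) ∷ _)     eq e⊆ = i , j , i≢j ,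
    full (∈-resp-↭ eq (here refl)) , full (∈-resp-↭ eq (there (here refl))) , e⊆
  split (_ ∷ _ ∷ _ ∷ _) _                   eq _  = contradiction (↭-length eq) λ ()

-- The classes meeting the union are exactly `i` and `j`, in whichever order `allFin` yields them;
-- each contributes its full size 2.
∪-edge : ∀ {n} {i j : Fin n} → i ≢ j → Edge n (class 2 i ∪ class 2 j)
∪-edge {n} {i} {j} i≢j =
  ∣unionOfClasses∣ 2 ij! (mk⇔ ∈-∪⁻ ∈-∪⁺) ,
  subst₂ _↭_ (sym (filter-map (_>? 0) size (allFin n)))
    (cong₂ (λ k l → k ∷ l ∷ []) (size-met (here refl)) (size-met (there (here refl))))
    (map⁺ size (unique∧set⇒↭ (filter⁺ _ (allFin⁺ n)) ij!
      (mk⇔ (λ k∈ → met⇒∈ij (proj₂ (∈-filter⁻ (λ k → size k >? 0) {xs = allFin n} k∈)))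
           (λ k∈ → ∈-filter⁺ (λ k → size k >? 0) (∈-allFin _) (subst (0 <_) (sym (size-met k∈)) z<s)))))
  where
  ij : List (Fin n)
  ij = i ∷ j ∷ []

  ij! : Unique ij
  ij! = unique-pair i≢j

  e : Subset (n * 2)
  e = class 2 i ∪ class 2 j

  size : Fin n → ℕ
  size k = ∣ e ∩ class 2 k ∣

  ∈-∪⁺ : ∀ {v} → quotient 2 v ∈ ij → v ∈ₛ e
  ∈-∪⁺ (here eq)         = x∈p∪q⁺ (inj₁ (∈-class⁺ 2 eq))
  ∈-∪⁺ (there (here eq)) = x∈p∪q⁺ (inj₂ (∈-class⁺ 2 eq))

  ∈-∪⁻ : ∀ {v} → v ∈ₛ e → quotient 2 v ∈ ij
  ∈-∪⁻ v∈ with x∈p∪q⁻ _ _ v∈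
  ... | inj₁ v∈i = here (∈-class⁻ 2 v∈i)
  ... | inj₂ v∈j = there (here (∈-class⁻ 2 v∈j))

  size-met : ∀ {k} → k ∈ ij → size k ≡ 2
  size-met {k} k∈ = trans
    (cong ∣_∣ (⊆-antisym (p∩q⊆q e (class 2 k))
      λ v∈ → x∈p∩q⁺ (∈-∪⁺ (subst (_∈ ij) (sym (∈-class⁻ 2 v∈)) k∈) , v∈)))
    (∣class∣ k)

  met⇒∈ij : ∀ {k} → 0 < size k → k ∈ ij
  met⇒∈ij {k} 0<size with member? _≟ᶠ_ k ij
  ... | yes k∈ = k∈
  -- A vertex of `e` in class `k` would put `k` into `ij`; so the intersection is a union of no
  -- classes and has size 0.
  ... | no  k∉ = contradiction (sym (∣unionOfClasses∣ {n} 2 {s = e ∩ class 2 k} {is = []} []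
    (mk⇔ (λ v∈ → let v∈e , v∈k = x∈p∩q⁻ e _ v∈ in
                 contradiction (subst (_∈ ij) (∈-class⁻ 2 v∈k) (∈-∪⁻ v∈e)) k∉) λ ())))
    (<⇒≢ 0<size)

-- Colourings with 2 and with `n` colours.

remainder-colouring : ∀ n → IsKColouring 2 2 2 (𝓗 (suc n) 4 2 (2 ∷ 2 ∷ [])) (toℕ ∘ remainder {suc n} 2)
remainder-colouring n =
  (λ e isEdge → let i , _ , _ , i⊆e , _ = edge⇒classes {suc n} e isEdge
                in 2≤ {s = e} i i⊆e , ≤2 e) ,
  -- All of `⊤` needs both colours because class `zero` exists, the number of classes being `suc n`.
  ≤-antisym (≤2 ⊤) (2≤ {s = ⊤} zero λ _ → ∈⊤)
  where
  c : Fin (suc n * 2) → ℕ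
  c = toℕ ∘ remainder {suc n} 2

  ≤2 : ∀ s → numColours c s ≤ 2
  ≤2 s = numColours≤length c s (0 ∷ 1 ∷ []) λ {v} _ → toℕ∈ (remainder {suc n} 2 v)
    where
    toℕ∈ : (r : Fin 2) → toℕ r ∈ 0 ∷ 1 ∷ []
    toℕ∈ zero       = here refl
    toℕ∈ (suc zero) = there (here refl)

  -- The two vertices of a class differ in position, which is their colour.
  2≤ : ∀ {s} i → class 2 i ⊆ s → 2 ≤ numColours c s
  2≤ {s} i i⊆s = length≤numColours c s {combine i zero ∷ combine i (suc zero) ∷ []}
    (unique-pair λ eq → contradiction
      (subst₂ _≡_ (cong toℕ (remainder-combine 2 i zero)) (cong toℕ (remainder-combine 2 i (suc zero))) eq) λ ())
    λ { (here refl)         → i⊆s (combine∈class 2 i zero)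
      ; (there (here refl)) → i⊆s (combine∈class 2 i (suc zero)) }

-- Each class has a colour of its own, so colours are counted by counting classes: two on an edge,
-- `n` on the whole vertex set.
quotient-colouring : ∀ n → IsKColouring n 2 2 (𝓗 n 4 2 (2 ∷ 2 ∷ [])) (toℕ ∘ quotient {n} 2)
quotient-colouring n =
  (λ e isEdge → let i , j , i≢j , i⊆e , j⊆e , e⊆ = edge⇒classes {n} e isEdge in
    length≤ {s = e} (unique-pair i≢j)
      (λ { (here refl)         → i⊆e (combine∈class 2 i zero)
         ; (there (here refl)) → j⊆e (combine∈class 2 j zero) }) ,
    ≤length e⊆) ,
  subst (numColours c ⊤ ≡_) (length-tabulate id)
    (≤-antisym (≤length {s = ⊤} {allFin n} λ _ → ∈-allFin _)
               (length≤ {s = ⊤} (allFin⁺ n) λ _ → ∈⊤))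
  where
  c : Fin (n * 2) → ℕ
  c = toℕ ∘ quotient {n} 2

  ≤length : ∀ {s is} → (∀ {v} → v ∈ₛ s → quotient {n} 2 v ∈ is) → numColours c s ≤ length is
  ≤length {s} {is} s⊆ = subst (numColours c s ≤_) (length-map toℕ is)
    (numColours≤length c s (map toℕ is) (∈-map⁺ toℕ ∘ s⊆))

  length≤ : ∀ {s is} → Unique is → (∀ {i} → i ∈ is → combine i zero ∈ₛ s) → length is ≤ numColours c s
  length≤ {s} {is} is! is⊆s = subst (_≤ numColours c s) (length-map first is)
    (length≤numColours c s
      (subst Unique (map-∘ is)
        (unique-map⁺ {f = c ∘ first}
          (subst₂ _≡_ (quotient-combine 2 _ zero) (quotient-combine 2 _ zero) ∘ toℕ-injective) is!))
      λ v∈ → let i , i∈ , eq = ∈-map⁻ first v∈ in subst (_∈ₛ s) (sym eq) (is⊆s i∈))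
    where
    first : Fin n → Fin (n * 2)
    first i = combine i zero

-- Every (2,2)-colouring has at most 2 or at least `n` colours.

module _ {n} (c : Fin (n * 2) → ℕ) (valid : IsColouring 2 2 (𝓗 n 4 2 (2 ∷ 2 ∷ [])) c) where

  Bichromatic : Fin n → Set
  Bichromatic i = c (combine i zero) ≢ c (combine i (suc zero))

  -- A vertex with a colour outside `ab` lies in another class, and the union of that class with
  -- class `i` would be an edge showing three colours.
  bichromatic⇒numColours≤2 : ∀ {i} → Bichromatic i → numColours c ⊤ ≤ 2
  bichromatic⇒numColours≤2 {i} a≢b = numColours≤length c ⊤ ab λ {v} _ → decidable-stable (member? _≟_ (c v) ab)
    λ cv∉ → <⇒≱ ≤-refl (≤-trans (three v cv∉) (proj₂ (valid _ (∪-edge (i≢quotient v cv∉)))))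
    where
    ab : List ℕ
    ab = c (combine i zero) ∷ c (combine i (suc zero)) ∷ []

    colour∈ab : ∀ r → c (combine i r) ∈ ab
    colour∈ab zero       = here refl
    colour∈ab (suc zero) = there (here refl)

    i≢quotient : ∀ v → ¬ c v ∈ ab → i ≢ quotient 2 v
    i≢quotient v cv∉ refl = cv∉ (subst (λ w → c w ∈ ab) (combine-remQuot {n} 2 v) (colour∈ab (remainder {n} 2 v)))

    three : ∀ v → ¬ c v ∈ ab → 3 ≤ numColours c (class 2 i ∪ class 2 (quotient {n} 2 v))
    three v cv∉ = length≤numColours c _ {v ∷ combine i zero ∷ combine i (suc zero) ∷ []}
      (((cv∉ ∘ here) ∷ (λ eq → cv∉ (there (here eq))) ∷ []) ∷ unique-pair a≢b)
      λ { (here refl)                 → x∈p∪q⁺ (inj₂ (∈-class⁺ 2 refl))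
        ; (there (here refl))         → x∈p∪q⁺ (inj₁ (combine∈class 2 i zero))
        ; (there (there (here refl))) → x∈p∪q⁺ (inj₁ (combine∈class 2 i (suc zero))) }

  -- The first vertices of the classes serve as `n` witnesses: two of equal colour would belong to
  -- monochromatic classes whose union is an edge with a single colour.
  monochromatic⇒n≤numColours : (∀ i → ¬ Bichromatic i) → n ≤ numColours c ⊤
  monochromatic⇒n≤numColours mono = subst (_≤ numColours c ⊤) (trans (length-map first (allFin n)) (length-tabulate id))
    (length≤numColours c ⊤ (subst Unique (map-∘ (allFin n)) (unique-map⁺ c∘first-injective (allFin⁺ n))) λ _ → ∈⊤)
    where
    first : Fin n → Fin (n * 2)
    first i = combine i zero

    colour : ∀ i r → c (combine i r) ≡ c (first i)
    colour i zero       = refl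
    colour i (suc zero) = sym (decidable-stable (_ ≟ _) (mono i))

    colour-class : ∀ {i v} → v ∈ₛ class 2 i → c v ≡ c (first i)
    colour-class {v = v} v∈ with refl ← ∈-class⁻ 2 v∈ =
      trans (cong c (sym (combine-remQuot {n} 2 v))) (colour _ (remainder {n} 2 v))

    c∘first-injective : ∀ {i j} → c (first i) ≡ c (first j) → i ≡ j
    c∘first-injective {i} {j} eq = decidable-stable (i ≟ᶠ j) λ i≢j →
      -- The edge would have at least 2 colours by validity and at most 1, as `one` shows.
      <⇒≱ ≤-refl (≤-trans (proj₁ (valid _ (∪-edge i≢j))) (numColours≤length c _ (c (first i) ∷ []) (here ∘ one)))
      where
      one : ∀ {v} → v ∈ₛ class 2 i ∪ class 2 j → c v ≡ c (first i)
      one v∈ with x∈p∪q⁻ _ _ v∈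
      ... | inj₁ v∈i = colour-class v∈i
      ... | inj₂ v∈j = trans (colour-class v∈j) (sym eq)

  numColours≤2⊎n≤numColours : numColours c ⊤ ≤ 2 ⊎ n ≤ numColours c ⊤
  numColours≤2⊎n≤numColours with any? (λ i → ¬? (c (combine i zero) ≟ c (combine i (suc zero))))
  ... | yes (_ , a≢b) = inj₁ (bichromatic⇒numColours≤2 a≢b)
  ... | no  none      = inj₂ (monochromatic⇒n≤numColours λ i a≢b → none (i , a≢b))

theorem4p1 : (n : ℕ) → n ≥ 4 → HasGap (Spectrum 2 2 (𝓗 n 4 2 (2 ∷ 2 ∷ [])))
theorem4p1 n@(suc _) n≥4 =
  -- The missing value is 3; `n≥4` unfolds to `3 < n`.
  2 , 3 , n , ≤-refl , n≥4 ,
  (z<s , _ , remainder-colouring _) ,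
  (z<s , _ , quotient-colouring n) ,
  λ (_ , c , valid , numColours≡3) →
    -- For exactly three colours the dichotomy reads `3 ≤ 2` or `n ≤ 3`, both impossible.
    case subst (λ k → k ≤ 2 ⊎ n ≤ k) numColours≡3 (numColours≤2⊎n≤numColours {n} c valid) of λ
    { (inj₁ 3≤2) → <⇒≱ ≤-refl 3≤2
    ; (inj₂ n≤3) → <⇒≱ n≥4 n≤3 }
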